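{- For all processes $s,t$ of a PTS, $s$ and $t$ are strong probabilistic trace equivalent if and only if $\mathcal{L}(s)=\mathcal{L}(t)$.
   Context: PTS $(\mathcal{S},A,\to)$ with finitely supported distributions; processes image-finite and finite. Computations $c=s_0\xrightarrow{a_1}\cdots\xrightarrow{a_n}s_n$ via transitions $s_{i-1}\xrightarrow{a_i}\pi_i$, $s_i\in\mathrm{supp}(\pi_i)$; $\Pr(c)=\prod\pi_i(s_i)$ (empty computation: 1); $|c|=n$; $\mathrm{tr}(c)=a_1\cdots a_n$; $\mathcal{C}(z,\alpha)$ = computations from $z$ with trace $\alpha$; maximal = not a proper prefix of another computation from the same process; $\mathcal{C}_{\max}(z)$; $\Pr$ of a set is the sum. A resolution of $s$ is a PTS $\mathcal{Z}=(Z,A,\to_{\mathcal{Z}})$ with $\mathrm{corr}\colon Z\to\mathcal{S}$ and initial state $z_s$, $\mathrm{corr}(z_s)=s$, such that $z_s$ is in no target support, every other state is in the support of a target of a transition from a different state, every $z\xrightarrow{a}_{\mathcal{Z}}\pi$ is matched by $\mathrm{corr}(z)\xrightarrow{a}\pi'$ with $\pi(z')=\pi'(\mathrm{corr}(z'))$, and each state has at most one outgoing transition; $\mathrm{res}(s)$ is the set of resolutions. $s,t$ are strong probabilistic trace equivalent iff for each $\mathcal{Z}_s\in\mathrm{res}(s)$ (initial state $z_s$) there is $\mathcal{Z}_t\in\mathrm{res}(t)$ (initial state $z_t$) with $\Pr(\mathcal{C}(z_s,\alpha))=\Pr(\mathcal{C}(z_t,\alpha))$ for all $\alpha\in A^\star$,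 and symmetrically with $s,t$ swapped. Logic $\mathcal{L}$: trace formulae $\Phi::=\top\mid\langle a\rangle\Phi$, $\mathrm{depth}(\top)=0$, $\mathrm{depth}(\langle a\rangle\Phi)=1+\mathrm{depth}(\Phi)$; trace distribution formulae $\bigoplus_{i\in I}r_i\Phi_i$ ($I$ finite nonempty, $\Phi_i$ pairwise distinct, $r_i\in(0,1]$, $\sum r_i=1$), identified with distributions on trace formulae. $c\models\top$ always; $c\models\langle a\rangle\Phi$ iff $c=s\xrightarrow{a}c'$ with $c'\models\Phi$. $s\models\bigoplus_i r_i\Phi_i$ iff some $\mathcal{Z}\in\mathrm{res}(s)$ with initial state $z$ satisfies $\Pr(\{c\in\mathcal{C}_{\max}(z):c\models\Phi_i,|c|=\mathrm{depth}(\Phi_i)\})=r_i$ for all $i$. $\mathcal{L}(s)$ is the set of trace distribution formulae satisfied by $s$. -}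

module Defs where

open import Level using (Level; suc)
open import Algebra.Bundles using (CommutativeRing)
open import Data.Fin.Base using (Fin)
open import Data.List.Base using (List; []; _∷_; length; lookup; map; foldr)
import Data.List.Membership.Setoid as Membership
import Data.List.Relation.Binary.Equality.Setoid as ListEquality
open import Data.List.Relation.Binary.Prefix.Heterogeneous using (Prefix)
open import Data.List.Relation.Unary.All using (All)
import Data.List.Relation.Unary.Unique.Setoid as Uniqueness
open import Data.Nat.Base using (ℕ; zero) renaming (suc to 1+_)
open import Data.Product.Base using (Σ-syntax; ∃; ∃-syntax; _×_; _,_; proj₁; proj₂)
open import Data.Product.Relation.Binary.Pointwise.NonDependent using (_×ₛ_)
open import Function.Base using (_∘_)
open import Function.Definitions using (Injective)
open import Induction.WellFounded using (WellFounded)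
open import Relation.Binary.Bundles using (Setoid)
open import Relation.Binary.Core using (Rel)
open import Relation.Binary.PropositionalEquality.Core using (_≡_; _≢_)
import Relation.Binary.PropositionalEquality.Properties as ≡
open import Relation.Binary.Structures using (IsTotalOrder)
open import Relation.Nullary.Negation.Core using (¬_)
open import Relation.Unary using (Pred)

-- Probabilities are taken in an arbitrary ordered field; the real numbers are
-- the intended instance.
record OrderedField (ℓ : Level) : Set (suc ℓ) where
  infix 4 _≤_ _<_
  field
    commutativeRing : CommutativeRing ℓ ℓ
  open CommutativeRing commutativeRing public
  field
    _≤_          : Rel Carrier ℓ
    isTotalOrder : IsTotalOrder _≈_ _≤_
    0≉1          : ¬ (0# ≈ 1#)
    inverse      : ∀ x → ¬ (x ≈ 0#) → ∃[ y ] x * y ≈ 1#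
    +-monoˡ-≤    : ∀ z {x y} → x ≤ y → x + z ≤ y + z
    *-nonneg     : ∀ {x y} → 0# ≤ x → 0# ≤ y → 0# ≤ x * y

  _<_ : Rel Carrier ℓ
  x < y = (x ≤ y) × ¬ (x ≈ y)

  open import Algebra.Definitions.RawMonoid +-rawMonoid public using (sum)

-- A finite subset of a setoid, as a duplicate-free list of its elements.
record Enumeration {ℓ} (X : Setoid ℓ ℓ) (P : Pred (Setoid.Carrier X) ℓ) : Set ℓ where
  open Setoid X using (Carrier)
  open Membership X using (_∈_)
  open Uniqueness X using (Unique)
  field
    elements : List Carrier
    unique   : Unique elements
    sound    : All P elements
    complete : ∀ x → P x → x ∈ elements

module Processes {ℓ} (F : OrderedField ℓ) (Act : Set ℓ) where

  open OrderedField F using (Carrier; _≈_; _≤_; _<_; 0#; 1#; _*_; sum; setoid)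

  ∑ : ∀ {X : Setoid ℓ ℓ} {P} → Enumeration X P → (Setoid.Carrier X → Carrier) → Carrier
  ∑ e f = sum (f ∘ lookup (Enumeration.elements e))

  record Distribution (X : Set ℓ) : Set ℓ where
    field
      mass          : X → Carrier
      nonneg        : ∀ x → 0# ≤ mass x
      finiteSupport : Enumeration (≡.setoid X) (λ x → 0# < mass x)
      total         : ∑ finiteSupport mass ≈ 1#

  open Distribution public using (mass)

  infix 4 _∈supp_
  _∈supp_ : ∀ {X} → X → Distribution X → Set ℓ
  x ∈supp π = 0# < mass π x

  -- Distributions are equal when their mass functions are; the list that
  -- witnesses finiteness of the support is irrelevant.
  distributionSetoid : Set ℓ → Setoid ℓ ℓ
  distributionSetoid X = record
    { Carrier       = Distribution X
    ; _≈_           = λ π ρ → ∀ x → mass π x ≈ mass ρ x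
    ; isEquivalence = record
      { refl  = λ x → F.refl
      ; sym   = λ p x → F.sym (p x)
      ; trans = λ p q x → F.trans (p x) (q x)
      }
    }
    where module F = Setoid setoid

  infix 4 _≈ᵈ_
  _≈ᵈ_ : ∀ {X} → Rel (Distribution X) ℓ
  _≈ᵈ_ {X} = Setoid._≈_ (distributionSetoid X)

  data TraceFormula : Set ℓ where
    ⊤ᶠ   : TraceFormula
    ⟨_⟩_ : Act → TraceFormula → TraceFormula

  depth : TraceFormula → ℕ
  depth ⊤ᶠ        = zero
  depth (⟨ a ⟩ Φ) = 1+ depth Φ

  record PTS : Set (suc ℓ) where
    infix 4 _⟶[_]_ _≈ᶜ_ _⊨ᶜ_
    field
      State   : Set ℓ
      _⟶[_]_ : State → Act → Distribution State → Set ℓ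

    ImageFinite : Set ℓ
    ImageFinite = ∀ s a → ∃[ πs ] (∀ π → s ⟶[ a ] π → π ∈ πs)
      where open Membership (distributionSetoid State)

    _successorOf_ : Rel State ℓ
    s′ successorOf s = ∃[ a ] ∃[ π ] s ⟶[ a ] π × s′ ∈supp π

    -- Every process is finite: there is no infinite computation.  A bound on
    -- the length of the computations from each process implies this.
    Finite : Set ℓ
    Finite = WellFounded _successorOf_

    -- A step of a computation records the action, the target distribution and
    -- the state chosen in its support; the source is left implicit.
    Step : Set ℓ
    Step = Act × Distribution State × State

    stepSetoid : Setoid ℓ ℓ
    stepSetoid = ≡.setoid Act ×ₛ (distributionSetoid State ×ₛ ≡.setoid State)

    computationSetoid : Setoid ℓ ℓ
    computationSetoid = ListEquality.≋-setoid stepSetoid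

    _≈ᶜ_ : Rel (List Step) ℓ
    _≈ᶜ_ = Setoid._≈_ computationSetoid

    data IsComputation : State → List Step → Set ℓ where
      []  : ∀ {s} → IsComputation s []
      _∷_ : ∀ {s a π s′ c} → s ⟶[ a ] π × s′ ∈supp π → IsComputation s′ c →
            IsComputation s ((a , π , s′) ∷ c)

    trace : List Step → List Act
    trace = map proj₁

    prob : List Step → Carrier
    prob = foldr (λ (_ , π , s′) p → mass π s′ * p) 1#

    𝓒 : State → List Act → Pred (List Step) ℓ
    𝓒 z α c = IsComputation z c × trace c ≡ α

    ProperPrefix : Rel (List Step) ℓ
    ProperPrefix c c′ = Prefix (Setoid._≈_ stepSetoid) c c′ × ¬ (c ≈ᶜ c′)

    𝓒max : State → Pred (List Step) ℓ
    𝓒max z c = IsComputation z c × ¬ (∃[ c′ ] IsComputation z c′ × ProperPrefix c c′)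

    -- Pr C p: the set C of computations is finite and its probability is p.
    Pr : Pred (List Step) ℓ → Carrier → Set ℓ
    Pr C p = Σ[ e ∈ Enumeration computationSetoid C ] ∑ e prob ≈ p

    data _⊨ᶜ_ : List Step → TraceFormula → Set ℓ where
      ⊤ᶠ  : ∀ {c} → c ⊨ᶜ ⊤ᶠ
      ⟨⟩_ : ∀ {a π s′ c Φ} → c ⊨ᶜ Φ → (a , π , s′) ∷ c ⊨ᶜ ⟨ a ⟩ Φ

    𝓒max⊨ : State → TraceFormula → Pred (List Step) ℓ
    𝓒max⊨ z Φ c = 𝓒max z c × c ⊨ᶜ Φ × length c ≡ depth Φ

  record Resolution (P : PTS) (s : PTS.State P) : Set (suc ℓ) where
    private module P = PTS P
    field
      pts : PTS
    open PTS pts public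
    field
      corr          : State → P.State
      init          : State
      corr-init     : corr init ≡ s
      init-fresh    : ∀ {z a π} → z ⟶[ a ] π → ¬ (init ∈supp π)
      reached       : ∀ z → z ≢ init →
                      ∃[ z′ ] ∃[ a ] ∃[ π ] z′ ≢ z × z′ ⟶[ a ] π × z ∈supp π
      matched       : ∀ {z a π} → z ⟶[ a ] π →
                      ∃[ π′ ] corr z P.⟶[ a ] π′ × (∀ z′ → mass π z′ ≈ mass π′ (corr z′))
      deterministic : ∀ {z a b π ρ} → z ⟶[ a ] π → z ⟶[ b ] ρ → a ≡ b × π ≈ᵈ ρ

  -- The formula ⨁ᵢ rᵢ Φᵢ.
  record TraceDistributionFormula : Set ℓ where
    field
      size-1   : ℕ
    I : Set
    I = Fin (1+ size-1)
    field
      r        : I → Carrier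
      Φ        : I → TraceFormula
      distinct : Injective _≡_ _≡_ Φ
      r>0      : ∀ i → 0# < r i
      r≤1      : ∀ i → r i ≤ 1#
      r-total  : sum r ≈ 1#

  module _ (P : PTS) where

    open PTS P using (State)

    infix 4 _⊨_ _⊑_

    _⊨_ : State → TraceDistributionFormula → Set (suc ℓ)
    s ⊨ Ψ = Σ[ Z ∈ Resolution P s ] let open Resolution Z in
            ∀ i → Pr (𝓒max⊨ init (Φ i)) (r i)
      where open TraceDistributionFormula Ψ

    𝓛 : State → Pred TraceDistributionFormula (suc ℓ)
    𝓛 s Ψ = s ⊨ Ψ

    _⊑_ : Rel State (suc ℓ)
    s ⊑ t =
      ∀ (Zs : Resolution P s) → Σ[ Zt ∈ Resolution P t ]
      let module Zs = Resolution Zs; module Zt = Resolution Zt in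
      ∀ α → ∃[ p ] Zs.Pr (Zs.𝓒 Zs.init α) p × Zt.Pr (Zt.𝓒 Zt.init α) p

    StrongTraceEquivalent : Rel State (suc ℓ)
    StrongTraceEquivalent s t = s ⊑ t × t ⊑ s

{-# OPTIONS --safe #-}
module Submission where

open import Defs
open import Axiom.ExcludedMiddle using (ExcludedMiddle)
open import Function.Bundles using (_⇔_; mk⇔)
open import Relation.Unary using (_≐_)

open import Data.Fin.Base using (zero; suc)
open import Data.List.Base
  using (List; []; _∷_; _++_; [_]; map; concat; length; lookup; filter; deduplicate)
open import Data.List.Membership.Propositional using (_∈_)
open import Data.List.Membership.Propositional.Properties
  using (∈-++⁺ˡ; ∈-++⁺ʳ; ∈-map⁺; ∈-lookup; ∈-filter⁻; ∈-deduplicate⁺)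
import Data.List.Membership.Setoid as Membership
import Data.List.Properties as List
import Data.List.Relation.Binary.Disjoint.Setoid as Disjointness
open import Data.List.Relation.Binary.Pointwise using (Pointwise-length)
open import Data.List.Relation.Binary.Pointwise.Base using ([]; _∷_)
open import Data.List.Relation.Binary.Prefix.Heterogeneous using (Prefix; []; _∷_)
open import Data.List.Relation.Unary.All using (All; []; _∷_)
import Data.List.Relation.Unary.All as All
import Data.List.Relation.Unary.All.Properties as All
open import Data.List.Relation.Unary.AllPairs using ([]; _∷_)
import Data.List.Relation.Unary.AllPairs as AllPairs
import Data.List.Relation.Unary.AllPairs.Properties as AllPairs
open import Data.List.Relation.Unary.Any using (here; there)
import Data.List.Relation.Unary.Any as Any
import Data.List.Relation.Unary.Any.Properties as Any
open import Data.List.Relation.Unary.Unique.DecPropositional.Properties using (deduplicate-!)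
import Data.List.Relation.Unary.Unique.Propositional.Properties as UniqueWords
import Data.List.Relation.Unary.Unique.Setoid as Uniqueness
import Data.List.Relation.Unary.Unique.Setoid.Properties as Unique
open import Data.Nat.Base using (zero; suc; s≤s; z≤n; _⊔_) renaming (_+_ to _+ℕ_; _<_ to _<ℕ_)
import Data.Nat.Properties as ℕ
open import Data.Product.Base using (_×_; _,_; proj₁; proj₂; ∃-syntax)
open import Data.Sum.Base using (_⊎_; inj₁; inj₂)
open import Data.Unit.Polymorphic.Base using (⊤)
open import Function.Base using (_∘_)
open import Induction.WellFounded using (Acc; acc; module Subrelation)
open import Relation.Binary.Bundles using (Setoid; Poset)
import Relation.Binary.Construct.On as On
open import Relation.Binary.PropositionalEquality.Core as ≡ using (_≡_; _≢_)
import Relation.Binary.PropositionalEquality.Properties as ≡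
open import Relation.Binary.Structures using (IsTotalOrder)
open import Relation.Nullary using (¬_; Dec; yes; no; contradiction)

-- In a resolution Z the computations form a finite tree.  Write tr(α) for the
-- probability of the trace α and mx(α) for that of the maximal computations with
-- trace α.  If the finite set U contains every maximal trace, then
--   tr(α) = Σ { mx(β) | β ∈ U, α a prefix of β },
-- and this system is triangular, so tr and mx determine each other.  A formula
-- prescribes mx on a finite set of total mass 1, and this leaves no mass for any
-- other maximal trace; conversely mx of a resolution is itself such a formula.

-- The condition on `U` must be one that the logic can transfer. A formula fixes `mx` on a finite
-- list and is silent elsewhere, so it does not say directly that `U` contains the maximal traces of
-- a second resolution; but it does give the total of `mx` over `U`. The prefix-sum identity is
-- therefore proved from `∑ₗ U mx ≈ 1#` alone. Its induction on `α` needs the same equality, for the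
-- left quotient of `U`, at every state in the support of the first target; it holds there because
-- each such sum is at most `1#` and their weighted average is `1#`. The system is triangular by
-- length: `α` is a prefix of itself, with coefficient `1#`, and otherwise only of longer words.
-- Excluded middle decides enabledness of actions, equality of words and positivity of weights.

module OrderedFieldProperties {ℓ} (F : OrderedField ℓ) where

  open OrderedField F hiding (zero)
  open IsTotalOrder isTotalOrder public
    using (antisym; total; ≤-respˡ-≈; ≤-respʳ-≈)
    renaming (refl to ≤-refl; trans to ≤-trans; reflexive to ≤-reflexive)
  open import Algebra.Properties.Ring ring public
    using (-‿distribˡ-*; -‿involutive; +-cancelʳ)
  open import Algebra.Properties.CommutativeSemigroup +-commutativeSemigroup public
    using (x∙yz≈y∙xz)
  open import Algebra.Properties.CommutativeMonoid.Sum +-commutativeMonoid using (∑-comm)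
  open import Algebra.Properties.Semiring.Sum semiring using (*-distribˡ-sum)

  poset : Poset ℓ ℓ ℓ
  poset = record { isPartialOrder = IsTotalOrder.isPartialOrder isTotalOrder }

  open import Relation.Binary.Reasoning.PartialOrder poset

  -- Order arithmetic in an ordered field.

  +-monoʳ-≤ : ∀ z {x y} → x ≤ y → z + x ≤ z + y
  +-monoʳ-≤ z {x} {y} x≤y = begin
    z + x ≈⟨ +-comm z x ⟩
    x + z ≤⟨ +-monoˡ-≤ z x≤y ⟩
    y + z ≈⟨ +-comm y z ⟩
    z + y ∎

  +-mono-≤ : ∀ {x y u v} → x ≤ y → u ≤ v → x + u ≤ y + v
  +-mono-≤ {y = y} {u} x≤y u≤v = ≤-trans (+-monoˡ-≤ u x≤y) (+-monoʳ-≤ y u≤v)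

  x+y-y≈x : ∀ x y → (x + y) - y ≈ x
  x+y-y≈x x y = trans (+-assoc x y (- y)) (trans (+-congˡ (-‿inverseʳ y)) (+-identityʳ x))

  +-cancelʳ-≤ : ∀ z {x y} → x + z ≤ y + z → x ≤ y
  +-cancelʳ-≤ z {x} {y} p = begin
    x           ≈⟨ x+y-y≈x x z ⟨
    (x + z) - z ≤⟨ +-monoˡ-≤ (- z) p ⟩
    (y + z) - z ≈⟨ x+y-y≈x y z ⟩
    y           ∎

  +-cancelˡ-≤ : ∀ z {x y} → z + x ≤ z + y → x ≤ y
  +-cancelˡ-≤ z {x} {y} p =
    +-cancelʳ-≤ z (≤-respˡ-≈ (+-comm z x) (≤-respʳ-≈ (+-comm z y) p))

  *-monoʳ-≤ : ∀ {z x y} → 0# ≤ z → x ≤ y → z * x ≤ z * y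
  *-monoʳ-≤ {z} {x} {y} 0≤z x≤y = +-cancelʳ-≤ (z * - x) (begin
    z * x + z * - x ≈⟨ distribˡ z x (- x) ⟨
    z * (x - x)     ≈⟨ *-congˡ (-‿inverseʳ x) ⟩
    z * 0#          ≈⟨ zeroʳ z ⟩
    0#              ≤⟨ *-nonneg 0≤z (≤-respˡ-≈ (-‿inverseʳ x) (+-monoˡ-≤ (- x) x≤y)) ⟩
    z * (y - x)     ≈⟨ distribˡ z y (- x) ⟩
    z * y + z * - x ∎)

  *-cancelˡ : ∀ {z x y} → 0# < z → z * x ≈ z * y → x ≈ y
  *-cancelˡ {z} {x} {y} (_ , 0≉z) zx≈zy with inverse z (0≉z ∘ sym)
  ... | z⁻¹ , zz⁻¹≈1 = begin-equality
    x             ≈⟨ undo x ⟨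
    z⁻¹ * (z * x) ≈⟨ *-congˡ zx≈zy ⟩
    z⁻¹ * (z * y) ≈⟨ undo y ⟩
    y             ∎
    where
    undo : ∀ w → z⁻¹ * (z * w) ≈ w
    undo w = begin-equality
      z⁻¹ * (z * w) ≈⟨ *-assoc z⁻¹ z w ⟨
      z⁻¹ * z * w   ≈⟨ *-congʳ (trans (*-comm z⁻¹ z) zz⁻¹≈1) ⟩
      1# * w        ≈⟨ *-identityˡ w ⟩
      w             ∎

  -- If `1# ≤ 0#`, then `- 1#` is nonnegative and hence so is its square, which is `1#`.
  0≤1 : 0# ≤ 1#
  0≤1 with total 0# 1#
  ... | inj₁ p = p
  ... | inj₂ 1≤0 = ≤-respʳ-≈ -1*-1≈1 (*-nonneg 0≤-1 0≤-1)
    where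
    0≤-1 : 0# ≤ - 1#
    0≤-1 = begin
      0#        ≈⟨ -‿inverseʳ 1# ⟨
      1# - 1#   ≤⟨ +-monoˡ-≤ (- 1#) 1≤0 ⟩
      0# - 1#   ≈⟨ +-identityˡ (- 1#) ⟩
      - 1#      ∎
    -1*-1≈1 : - 1# * - 1# ≈ 1#
    -1*-1≈1 = begin-equality
      - 1# * - 1#    ≈⟨ -‿distribˡ-* 1# (- 1#) ⟨
      - (1# * - 1#)  ≈⟨ -‿cong (*-identityˡ (- 1#)) ⟩
      - - 1#         ≈⟨ -‿involutive 1# ⟩
      1#             ∎

  <-respʳ-≈ : ∀ {x y z} → y ≈ z → x < y → x < z
  <-respʳ-≈ y≈z (x≤y , x≉y) = ≤-respʳ-≈ y≈z x≤y , λ x≈z → x≉y (trans x≈z (sym y≈z))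

  -- Finite sums over lists.

  ∑ₗ : ∀ {a} {A : Set a} → List A → (A → Carrier) → Carrier
  ∑ₗ xs f = sum (f ∘ lookup xs)

  module _ {a} {A : Set a} where

    ∑-cong∈ : ∀ {f g : A → Carrier} xs → (∀ {x} → x ∈ xs → f x ≈ g x) → ∑ₗ xs f ≈ ∑ₗ xs g
    ∑-cong∈ []       p = refl
    ∑-cong∈ (x ∷ xs) p = +-cong (p (here ≡.refl)) (∑-cong∈ xs (p ∘ there))

    ∑-cong : ∀ {f g : A → Carrier} xs → (∀ x → f x ≈ g x) → ∑ₗ xs f ≈ ∑ₗ xs g
    ∑-cong xs p = ∑-cong∈ xs λ {x} _ → p x

    ∑-zero : ∀ {f : A → Carrier} xs → (∀ {x} → x ∈ xs → f x ≈ 0#) → ∑ₗ xs f ≈ 0#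
    ∑-zero []       p = refl
    ∑-zero (x ∷ xs) p = trans (+-cong (p (here ≡.refl)) (∑-zero xs (p ∘ there))) (+-identityˡ 0#)

    ∑-mono : ∀ {f g : A → Carrier} xs → (∀ {x} → x ∈ xs → f x ≤ g x) → ∑ₗ xs f ≤ ∑ₗ xs g
    ∑-mono []       p = ≤-refl
    ∑-mono (x ∷ xs) p = +-mono-≤ (p (here ≡.refl)) (∑-mono xs (p ∘ there))

    ∑-nonneg : ∀ {f : A → Carrier} xs → (∀ x → 0# ≤ f x) → 0# ≤ ∑ₗ xs f
    ∑-nonneg xs p = ≤-respˡ-≈ (∑-zero xs λ _ → refl) (∑-mono xs λ {x} _ → p x)

    ∑-++ : ∀ (f : A → Carrier) xs ys → ∑ₗ (xs ++ ys) f ≈ ∑ₗ xs f + ∑ₗ ys f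
    ∑-++ f []       ys = sym (+-identityˡ _)
    ∑-++ f (x ∷ xs) ys = trans (+-congˡ (∑-++ f xs ys)) (sym (+-assoc _ _ _))

    ∑-distribˡ : ∀ (f : A → Carrier) c xs → c * ∑ₗ xs f ≈ ∑ₗ xs (λ x → c * f x)
    ∑-distribˡ f c xs = *-distribˡ-sum c (f ∘ lookup xs)

    -- Monotonicity compares the sums over all other entries; cancelling them from the reversed
    -- inequality leaves `g x ≤ f x`.
    ∑-squeeze : ∀ {f g : A → Carrier} xs → (∀ {x} → x ∈ xs → f x ≤ g x) →
                ∑ₗ xs g ≤ ∑ₗ xs f → ∀ {x} → x ∈ xs → f x ≈ g x
    ∑-squeeze {f} {g} (x ∷ xs) f≤g Σg≤Σf (here ≡.refl) =
      antisym (f≤g (here ≡.refl))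
        (+-cancelʳ-≤ (∑ₗ xs g) (≤-trans Σg≤Σf (+-monoʳ-≤ (f x) (∑-mono xs (f≤g ∘ there)))))
    ∑-squeeze {f} {g} (x ∷ xs) f≤g Σg≤Σf (there x∈xs) =
      ∑-squeeze xs (f≤g ∘ there)
        (+-cancelˡ-≤ (g x) (≤-trans Σg≤Σf (+-monoˡ-≤ (∑ₗ xs f) (f≤g (here ≡.refl))))) x∈xs

  ∑-swap : ∀ {a b} {A : Set a} {B : Set b} (f : A → B → Carrier) xs ys →
           ∑ₗ xs (λ x → ∑ₗ ys (f x)) ≈ ∑ₗ ys (λ y → ∑ₗ xs (λ x → f x y))
  ∑-swap f xs ys = ∑-comm λ i j → f (lookup xs i) (lookup ys j)

  ∑-map : ∀ {a b} {A : Set a} {B : Set b} (h : A → B) (f : B → Carrier) xs →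
          ∑ₗ (map h xs) f ≈ ∑ₗ xs (f ∘ h)
  ∑-map h f []       = refl
  ∑-map h f (x ∷ xs) = +-congˡ (∑-map h f xs)

  ∑-concat-map : ∀ {a b} {A : Set a} {B : Set b} (h : A → List B) (f : B → Carrier) xs →
                 ∑ₗ (concat (map h xs)) f ≈ ∑ₗ xs (λ x → ∑ₗ (h x) f)
  ∑-concat-map h f []       = refl
  ∑-concat-map h f (x ∷ xs) = trans (∑-++ f (h x) _) (+-congˡ (∑-concat-map h f xs))

  module _ {a} (X : Setoid a ℓ) where
    open Setoid X using () renaming (Carrier to A; _≈_ to _∼_; sym to ∼-sym; trans to ∼-trans)
    open Membership X using () renaming (_∈_ to _∈ₓ_)
    open Uniqueness X using (Unique)

    -- A subtraction-free form of `∑ f - ∑ g = f x - g x`, which also avoids forming the list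
    -- without `x`. With `g` zero it isolates a single term; with equal sums it cancels to
    -- `f x ≈ g x`, which is the elimination step of the triangular system.
    ∑-agree-off : ∀ {f g : A → Carrier} →
                  (∀ {x y} → x ∼ y → f x ≈ f y) → (∀ {x y} → x ∼ y → g x ≈ g y) →
                  ∀ {x xs} → Unique xs → x ∈ₓ xs →
                  (∀ {y} → y ∈ xs → ¬ x ∼ y → f y ≈ g y) →
                  f x + ∑ₗ xs g ≈ g x + ∑ₗ xs f
    ∑-agree-off {f} {g} f-cong g-cong {x} {y ∷ ys} (y∉ys ∷ _) (here x∼y) f≈g = begin-equality
      f x + (g y + ∑ₗ ys g) ≈⟨ x∙yz≈y∙xz _ _ _ ⟩
      g y + (f x + ∑ₗ ys g) ≈⟨ +-cong (g-cong (∼-sym x∼y)) (+-cong (f-cong x∼y) (∑-cong∈ ys agree)) ⟩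
      g x + (f y + ∑ₗ ys f) ∎
      where
      agree : ∀ {z} → z ∈ ys → g z ≈ f z
      agree z∈ys = sym (f≈g (there z∈ys) λ x∼z →
        All.lookup y∉ys z∈ys (∼-trans (∼-sym x∼y) x∼z))
    ∑-agree-off {f} {g} f-cong g-cong {x} {y ∷ ys} (y∉ys ∷ u) (there x∈ys) f≈g = begin-equality
      f x + (g y + ∑ₗ ys g) ≈⟨ x∙yz≈y∙xz _ _ _ ⟩
      g y + (f x + ∑ₗ ys g) ≈⟨ +-cong (sym (f≈g (here ≡.refl) x≁y))
                                 (∑-agree-off f-cong g-cong u x∈ys (f≈g ∘ there)) ⟩
      f y + (g x + ∑ₗ ys f) ≈⟨ x∙yz≈y∙xz _ _ _ ⟩
      g x + (f y + ∑ₗ ys f) ∎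
      where
      x≁y : ¬ x ∼ y
      x≁y x∼y with All.lookupAny y∉ys x∈ys
      ... | y≁z , x∼z = y≁z (∼-trans (∼-sym x∼y) x∼z)

    ∑-single : ∀ {f : A → Carrier} → (∀ {x y} → x ∼ y → f x ≈ f y) →
               ∀ {x xs} → Unique xs → x ∈ₓ xs →
               (∀ {y} → y ∈ xs → ¬ x ∼ y → f y ≈ 0#) → ∑ₗ xs f ≈ f x
    ∑-single {f} f-cong {x} {xs} u x∈xs f≈0 = begin-equality
      ∑ₗ xs f               ≈⟨ +-identityˡ _ ⟨
      0# + ∑ₗ xs f          ≈⟨ ∑-agree-off f-cong (λ _ → refl) u x∈xs f≈0 ⟨
      f x + ∑ₗ xs (λ _ → 0#) ≈⟨ +-congˡ (∑-zero xs λ _ → refl) ⟩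
      f x + 0#              ≈⟨ +-identityʳ _ ⟩
      f x                   ∎

module Classical {ℓ} (lem : ExcludedMiddle ℓ) (F : OrderedField ℓ) (Act : Set ℓ) where

  open OrderedField F hiding (zero)
  open OrderedFieldProperties F
  open Processes F Act
  open import Data.List.Relation.Unary.Unique.Propositional using (Unique)
  open import Relation.Binary.Reasoning.PartialOrder poset

  -- Sums over a finite subset do not depend on its enumeration.

  module _ (X : Setoid ℓ ℓ) where
    open Setoid X using ()
      renaming (Carrier to A; _≈_ to _∼_; refl to ∼-refl; sym to ∼-sym; trans to ∼-trans)
    open Membership X using () renaming (_∈_ to _∈ₓ_)

    private
      δ : A → A → Carrier
      δ x y with lem {x ∼ y}
      ... | yes _ = 1#
      ... | no  _ = 0#

      δ-yes : ∀ {x y} → x ∼ y → δ x y ≈ 1#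
      δ-yes {x} {y} x∼y with lem {x ∼ y}
      ... | yes _  = refl
      ... | no x≁y = contradiction x∼y x≁y

      δ-no : ∀ {x y} → ¬ x ∼ y → δ x y ≈ 0#
      δ-no {x} {y} x≁y with lem {x ∼ y}
      ... | yes x∼y = contradiction x∼y x≁y
      ... | no _    = refl

      δ-cong : ∀ {x y x′ y′} → x ∼ x′ → y ∼ y′ → δ x y ≈ δ x′ y′
      δ-cong {x} {y} x∼x′ y∼y′ with lem {x ∼ y}
      ... | yes x∼y = sym (δ-yes (∼-trans (∼-sym x∼x′) (∼-trans x∼y y∼y′)))
      ... | no x≁y  = sym (δ-no λ x′∼y′ → x≁y (∼-trans x∼x′ (∼-trans x′∼y′ (∼-sym y∼y′))))

    module _ (f : A → Carrier) (f-cong : ∀ {x y} → x ∼ y → f x ≈ f y) where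

      -- Double counting: the matrix `δ x y * f y` has row sums `f x` and column sums `f y`, because
      -- each element of one list matches exactly one of the other up to `_∼_`. This makes the value
      -- `p` in `Pr C p` unique, although every proof of it brings its own enumeration.
      ∑-Enumeration-unique : ∀ {P} (d e : Enumeration X P) → ∑ d f ≈ ∑ e f
      ∑-Enumeration-unique {P} d e = begin-equality
        ∑ₗ xs f                                ≈⟨ ∑-cong∈ xs (λ x∈xs → sym (row (All.lookup D.sound x∈xs))) ⟩
        ∑ₗ xs (λ x → ∑ₗ ys (λ y → δ x y * f y)) ≈⟨ ∑-swap (λ x y → δ x y * f y) xs ys ⟩
        ∑ₗ ys (λ y → ∑ₗ xs (λ x → δ x y * f y)) ≈⟨ ∑-cong∈ ys (λ y∈ys → column (All.lookup E.sound y∈ys)) ⟩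
        ∑ₗ ys f                                ∎
        where
        module D = Enumeration d
        module E = Enumeration e
        xs = D.elements
        ys = E.elements
        diagonal : ∀ x → δ x x * f x ≈ f x
        diagonal x = trans (*-congʳ (δ-yes ∼-refl)) (*-identityˡ (f x))
        row : ∀ {x} → P x → ∑ₗ ys (λ y → δ x y * f y) ≈ f x
        row {x} px = trans
          (∑-single X (λ y∼y′ → *-cong (δ-cong ∼-refl y∼y′) (f-cong y∼y′)) E.unique (E.complete x px)
            λ _ x≁y → trans (*-congʳ (δ-no x≁y)) (zeroˡ _))
          (diagonal x)
        column : ∀ {y} → P y → ∑ₗ xs (λ x → δ x y * f y) ≈ f y
        column {y} py = trans
          (∑-single X (λ x∼x′ → *-congʳ (δ-cong x∼x′ ∼-refl)) D.unique (D.complete y py)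
            λ _ y≁x → trans (*-congʳ (δ-no (y≁x ∘ ∼-sym))) (zeroˡ _))
          (diagonal y)

  -- Words and the triangular system of prefix sums.

  Word : Set ℓ
  Word = List Act

  -- The indicator of the prefix relation, valued in the field so that it can be the coefficient
  -- matrix of a linear system.
  ⟦_≼_⟧ : Word → Word → Carrier
  ⟦ []    ≼ β     ⟧ = 1#
  ⟦ a ∷ α ≼ []    ⟧ = 0#
  ⟦ a ∷ α ≼ b ∷ β ⟧ with lem {a ≡ b}
  ... | yes _ = ⟦ α ≼ β ⟧
  ... | no  _ = 0#

  ≼-∷ : ∀ a α β → ⟦ a ∷ α ≼ a ∷ β ⟧ ≈ ⟦ α ≼ β ⟧
  ≼-∷ a α β with lem {a ≡ a}
  ... | yes _  = refl
  ... | no a≢a = contradiction ≡.refl a≢a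

  ≼-refl : ∀ α → ⟦ α ≼ α ⟧ ≈ 1#
  ≼-refl []      = refl
  ≼-refl (a ∷ α) = trans (≼-∷ a α α) (≼-refl α)

  -- Triangularity of the matrix: off the diagonal, a nonzero coefficient occurs only at a strictly
  -- longer word.
  ≼-cases : ∀ α β → ⟦ α ≼ β ⟧ ≈ 0# ⊎ α ≡ β ⊎ length α <ℕ length β
  ≼-cases []      []      = inj₂ (inj₁ ≡.refl)
  ≼-cases []      (b ∷ β) = inj₂ (inj₂ (s≤s z≤n))
  ≼-cases (a ∷ α) []      = inj₁ refl
  ≼-cases (a ∷ α) (b ∷ β) with lem {a ≡ b}
  ... | no _       = inj₁ refl
  ... | yes ≡.refl with ≼-cases α β
  ...   | inj₁ p             = inj₁ p
  ...   | inj₂ (inj₁ ≡.refl) = inj₂ (inj₁ ≡.refl)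
  ...   | inj₂ (inj₂ p)      = inj₂ (inj₂ (s≤s p))

  length-bounded : ∀ (U : List Word) → ∃[ n ] (∀ {β} → β ∈ U → length β <ℕ n)
  length-bounded []      = zero , λ ()
  length-bounded (α ∷ U) with length-bounded U
  ... | n , bound = suc (length α) ⊔ n , λ
    { (here ≡.refl) → ℕ.m≤m⊔n _ n
    ; (there β∈U)   → ℕ.m≤n⇒m≤o⊔n (suc (length α)) (bound β∈U) }

  -- Induction from the longest words down: two functions with equal prefix sums
  -- that agree on all proper extensions of α agree at α.
  prefix-sums-determine : ∀ (f g : Word → Carrier) {U} → Unique U →
    (∀ α → ∑ₗ U (λ β → ⟦ α ≼ β ⟧ * f β) ≈ ∑ₗ U (λ β → ⟦ α ≼ β ⟧ * g β)) →
    ∀ {α} → α ∈ U → f α ≈ g α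
  prefix-sums-determine f g {U} u sums {α} α∈U with length-bounded U
  ... | n , bound = go n α∈U λ β∈U → ℕ.≤-trans (bound β∈U) (ℕ.m≤m+n n _)
    where
    -- `n` is fuel: every length in `U` is below `n +ℕ length α`. Passing to a longer word pays for
    -- the decrease of `n`, and at `zero` the word `α` itself violates the bound.
    go : ∀ n {α} → α ∈ U → (∀ {β} → β ∈ U → length β <ℕ n +ℕ length α) → f α ≈ g α
    go zero    α∈U bound = contradiction (bound α∈U) (ℕ.<-irrefl ≡.refl)
    go (suc n) {α} α∈U bound = begin-equality
      f α               ≈⟨ diagonal f ⟨
      ⟦ α ≼ α ⟧ * f α   ≈⟨ +-cancelʳ _ _ _ (trans
                             (∑-agree-off (≡.setoid Word) (λ { ≡.refl → refl }) (λ { ≡.refl → refl })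
                               u α∈U agree)
                             (+-congˡ (sums α))) ⟩
      ⟦ α ≼ α ⟧ * g α   ≈⟨ diagonal g ⟩
      g α               ∎
      where
      diagonal : ∀ (h : Word → Carrier) → ⟦ α ≼ α ⟧ * h α ≈ h α
      diagonal h = trans (*-congʳ (≼-refl α)) (*-identityˡ (h α))
      agree : ∀ {β} → β ∈ U → ¬ α ≡ β → ⟦ α ≼ β ⟧ * f β ≈ ⟦ α ≼ β ⟧ * g β
      agree {β} β∈U α≢β with ≼-cases α β
      ... | inj₁ p          = trans (trans (*-congʳ p) (zeroˡ _)) (sym (trans (*-congʳ p) (zeroˡ _)))
      ... | inj₂ (inj₁ α≡β) = contradiction α≡β α≢β
      ... | inj₂ (inj₂ α<β) = *-congˡ (go n β∈U λ γ∈U →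
        ℕ.≤-trans (bound γ∈U) (ℕ.≤-trans (ℕ.≤-reflexive (≡.sym (ℕ.+-suc n _))) (ℕ.+-monoʳ-≤ n α<β)))

  -- Left quotients of finite sets of words by a letter.

  residual : Act → List Word → List Word
  residual a []            = []
  residual a ([] ∷ U)      = residual a U
  residual a ((b ∷ β) ∷ U) with lem {a ≡ b}
  ... | yes _ = β ∷ residual a U
  ... | no  _ = residual a U

  ∈-residual⁺ : ∀ {a β} U → a ∷ β ∈ U → β ∈ residual a U
  ∈-residual⁺ ([] ∷ U)      (there p) = ∈-residual⁺ U p
  ∈-residual⁺ {a} ((b ∷ γ) ∷ U) p with lem {a ≡ b} | p
  ... | yes _  | here ≡.refl = here ≡.refl
  ... | yes _  | there q     = there (∈-residual⁺ U q)
  ... | no a≢b | here ≡.refl = contradiction ≡.refl a≢b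
  ... | no _   | there q     = ∈-residual⁺ U q

  ∈-residual⁻ : ∀ {a β} U → β ∈ residual a U → a ∷ β ∈ U
  ∈-residual⁻ ([] ∷ U)      p = there (∈-residual⁻ U p)
  ∈-residual⁻ {a} ((b ∷ γ) ∷ U) p with lem {a ≡ b} | p
  ... | yes ≡.refl | here ≡.refl = here ≡.refl
  ... | yes _      | there q     = there (∈-residual⁻ U q)
  ... | no _       | q           = there (∈-residual⁻ U q)

  residual-unique : ∀ {a U} → Unique U → Unique (residual a U)
  residual-unique []                         = []
  residual-unique {U = [] ∷ _} (_ ∷ u)       = residual-unique u
  residual-unique {a} {(b ∷ β) ∷ U} (p ∷ u) with lem {a ≡ b}
  ... | yes ≡.refl =
    All.tabulate (λ γ∈ → λ { ≡.refl → All.lookup p (∈-residual⁻ U γ∈) ≡.refl }) ∷ residual-unique u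
  ... | no _       = residual-unique u

  ∑-residual : ∀ {a} (f : Word → Carrier) → f [] ≈ 0# → (∀ {b β} → a ≢ b → f (b ∷ β) ≈ 0#) →
               ∀ U → ∑ₗ U f ≈ ∑ₗ (residual a U) (f ∘ (a ∷_))
  ∑-residual f f[] f∷ []       = refl
  ∑-residual f f[] f∷ ([] ∷ U) = trans (+-cong f[] (∑-residual f f[] f∷ U)) (+-identityˡ _)
  ∑-residual {a} f f[] f∷ ((b ∷ β) ∷ U) with lem {a ≡ b}
  ... | yes ≡.refl = +-congˡ (∑-residual f f[] f∷ U)
  ... | no a≢b     = trans (+-cong (f∷ a≢b) (∑-residual f f[] f∷ U)) (+-identityˡ _)

  -- Duplicate-free lists of words and positive weights.

  lookup-injective : ∀ {U : List Word} → Unique U → ∀ i j → lookup U i ≡ lookup U j → i ≡ j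
  lookup-injective (_ ∷ _) zero    zero    _  = ≡.refl
  lookup-injective (p ∷ _) zero    (suc j) eq = contradiction eq (All.lookup p (∈-lookup j))
  lookup-injective (p ∷ _) (suc i) zero    eq = contradiction (≡.sym eq) (All.lookup p (∈-lookup i))
  lookup-injective (_ ∷ u) (suc i) (suc j) eq = ≡.cong suc (lookup-injective u i j eq)

  -- A nonnegative value that is not positive is zero, so dropping it changes nothing. Formulae
  -- admit only positive coefficients, which is why such words have to go.
  ∑-filter-positive : ∀ (f : Word → Carrier) → (∀ β → 0# ≤ f β) → ∀ U →
                      ∑ₗ (filter (λ β → lem {0# < f β}) U) f ≈ ∑ₗ U f
  ∑-filter-positive f 0≤f []      = refl
  ∑-filter-positive f 0≤f (β ∷ U) with lem {0# < f β}
  ... | yes _  = +-congˡ (∑-filter-positive f 0≤f U)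
  ... | no ¬0< with lem {0# ≈ f β}
  ...   | yes 0≈fβ = trans (sym (+-identityˡ _)) (+-cong 0≈fβ (∑-filter-positive f 0≤f U))
  ...   | no 0≉fβ  = contradiction (0≤f β , 0≉fβ) ¬0<

  dedup : List Word → List Word
  dedup = deduplicate (λ α β → lem {α ≡ β})

  dedup-unique : ∀ U → Unique (dedup U)
  dedup-unique = deduplicate-! (λ α β → lem {α ≡ β})

  ∈-dedup⁺ : ∀ {U β} → β ∈ U → β ∈ dedup U
  ∈-dedup⁺ = ∈-deduplicate⁺ (λ α β → lem {α ≡ β})

  -- Trace formulae as words.

  word : TraceFormula → Word
  word ⊤ᶠ        = []
  word (⟨ a ⟩ Φ) = a ∷ word Φ

  formula : Word → TraceFormula
  formula []      = ⊤ᶠ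
  formula (a ∷ α) = ⟨ a ⟩ formula α

  word-formula : ∀ α → word (formula α) ≡ α
  word-formula []      = ≡.refl
  word-formula (a ∷ α) = ≡.cong (a ∷_) (word-formula α)

  -- Supports of distributions.

  support : ∀ {X} → Distribution X → List X
  support π = Enumeration.elements (Distribution.finiteSupport π)

  ∈-support⇒∈supp : ∀ {X} (π : Distribution X) {x} → x ∈ support π → x ∈supp π
  ∈-support⇒∈supp π = All.lookup (Enumeration.sound (Distribution.finiteSupport π))

  -- Equal mass functions may come with differently ordered supports. The list for `π` also
  -- enumerates the support of `ρ`, so independence of the enumeration applies.
  ∑-support-cong : ∀ {X} (π ρ : Distribution X) → π ≈ᵈ ρ → (f : X → Carrier) →
                   ∑ₗ (support π) (λ x → mass π x * f x) ≈ ∑ₗ (support ρ) (λ x → mass ρ x * f x)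
  ∑-support-cong {X} π ρ π≈ρ f = trans
    (∑-cong (support π) (λ x → *-congʳ {f x} (π≈ρ x)))
    (∑-Enumeration-unique (≡.setoid X) (λ x → mass ρ x * f x) (λ { ≡.refl → refl })
      π′ (Distribution.finiteSupport ρ))
    where
    module E = Enumeration (Distribution.finiteSupport π)
    π′ : Enumeration (≡.setoid X) (_∈supp ρ)
    π′ = record
      { elements = E.elements
      ; unique   = E.unique
      ; sound    = All.map (λ {x} → <-respʳ-≈ (π≈ρ x)) E.sound
      ; complete = λ x → E.complete x ∘ <-respʳ-≈ (sym (π≈ρ x))
      }

  -- Computations of a finite deterministic system.

  Deterministic : PTS → Set ℓ
  Deterministic Z = ∀ {z a b π ρ} → z ⟶[ a ] π → z ⟶[ b ] ρ → a ≡ b × π ≈ᵈ ρ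
    where open PTS Z

  module DeterministicPTS (Z : PTS) (deterministic : Deterministic Z) (finite : PTS.Finite Z) where

    open PTS Z

    Terminal : State → Set ℓ
    Terminal z = ¬ (∃[ a ] ∃[ π ] z ⟶[ a ] π)

    last : State → List Step → State
    last z []                 = z
    last z ((_ , _ , s) ∷ c) = last s c

    open Membership computationSetoid using () renaming (_∈_ to _∈ᶜ_)
    open Uniqueness computationSetoid using () renaming (Unique to Uniqueᶜ)
    open Disjointness computationSetoid using (Disjoint)

    prob-cong : ∀ {c d} → c ≈ᶜ d → prob c ≈ prob d
    prob-cong []                                          = refl
    prob-cong (_∷_ {_ , _ , s} (_ , π≈ρ , ≡.refl) c≈d) = *-cong (π≈ρ s) (prob-cong c≈d)

    prob-nonneg : ∀ c → 0# ≤ prob c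
    prob-nonneg []                = 0≤1
    prob-nonneg ((_ , π , s) ∷ c) = *-nonneg (Distribution.nonneg π s) (prob-nonneg c)

    Pr-unique : ∀ {C p q} → Pr C p → Pr C q → p ≈ q
    Pr-unique (d , Σd≈p) (e , Σe≈q) =
      trans (sym Σd≈p) (trans (∑-Enumeration-unique computationSetoid prob prob-cong d e) Σe≈q)

    Pr-resp-≐ : ∀ {C D p} → C ≐ D → Pr C p → Pr D p
    Pr-resp-≐ (C⊆D , D⊆C) (e , Σe≈p) = record
      { elements = elements
      ; unique   = unique
      ; sound    = All.map C⊆D sound
      ; complete = λ c → complete c ∘ D⊆C
      } , Σe≈p
      where open Enumeration e

    module _ (E : State → Set ℓ) where

      -- The condition `E` on the last state lets one enumeration serve twice: the trivial `E` gives
      -- all computations with trace `α`, and `Terminal` gives the maximal ones.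
      𝓒ᴱ : State → Word → List Step → Set ℓ
      𝓒ᴱ z α c = IsComputation z c × trace c ≡ α × E (last z c)

      computations : State → Word → List (List Step)
      computations z [] with lem {E z}
      ... | yes _ = [ [] ]
      ... | no  _ = []
      computations z (a ∷ α) with lem {∃[ π ] z ⟶[ a ] π}
      ... | yes (π , _) = concat (map (λ s → map ((a , π , s) ∷_) (computations s α)) (support π))
      ... | no _        = []

      computations-sound : ∀ z α → All (𝓒ᴱ z α) (computations z α)
      computations-sound z [] with lem {E z}
      ... | yes e = ([] , ≡.refl , e) ∷ []
      ... | no  _ = []
      computations-sound z (a ∷ α) with lem {∃[ π ] z ⟶[ a ] π}
      ... | no _         = []
      ... | yes (π , st) = All.concat⁺ (All.map⁺ (All.map
        (λ {s} s∈π → All.map⁺ (All.map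
          (λ (c , tr , e) → (st , s∈π) ∷ c , ≡.cong (a ∷_) tr , e)
          (computations-sound s α)))
        (Enumeration.sound (Distribution.finiteSupport π))))

      computations-unique : ∀ z α → Uniqueᶜ (computations z α)
      computations-unique z [] with lem {E z}
      ... | yes _ = [] ∷ []
      ... | no  _ = []
      computations-unique z (a ∷ α) with lem {∃[ π ] z ⟶[ a ] π}
      ... | no _         = []
      ... | yes (π , st) = Unique.concat⁺ computationSetoid
        (All.map⁺ (All.tabulate λ {s} _ →
          Unique.map⁺ computationSetoid computationSetoid (λ { (_ ∷ p) → p }) (computations-unique s α)))
        (AllPairs.map⁺ (AllPairs.map disjoint (Enumeration.unique (Distribution.finiteSupport π))))
        where
        disjoint : ∀ {s s′} → s ≢ s′ →
                   Disjoint (map ((a , π , s) ∷_) (computations s α))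
                            (map ((a , π , s′) ∷_) (computations s′ α))
        disjoint s≢s′ (p , q) with Any.satisfied (Any.map⁻ p) | Any.satisfied (Any.map⁻ q)
        ... | _ , (_ , _ , ≡.refl) ∷ _ | _ , (_ , _ , ≡.refl) ∷ _ = s≢s′ ≡.refl

      -- The enumeration follows only the target `ρ` chosen by excluded middle. Determinism makes
      -- every other target equal to it in mass, and computations are listed only up to that
      -- equality.
      computations-complete : ∀ {z α c} → 𝓒ᴱ z α c → c ∈ᶜ computations z α
      computations-complete {z} ([] , ≡.refl , e) with lem {E z}
      ... | yes _ = here []
      ... | no ¬e = contradiction e ¬e
      computations-complete {z} {a ∷ α} (_∷_ {π = π} {s} (st , s∈π) c , ≡.refl , e)
        with lem {∃[ ρ ] z ⟶[ a ] ρ}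
      ... | no ¬st       = contradiction (π , st) ¬st
      ... | yes (ρ , st′) = Any.concat⁺ (Any.map⁺ (Any.map
        (λ { ≡.refl → Any.map⁺ (Any.map ((≡.refl , π≈ρ , ≡.refl) ∷_)
                                  (computations-complete (c , ≡.refl , e))) })
        (Enumeration.complete (Distribution.finiteSupport ρ) s (<-respʳ-≈ (π≈ρ s) s∈π))))
        where
        π≈ρ : π ≈ᵈ ρ
        π≈ρ = proj₂ (deterministic st st′)

      weight : State → Word → Carrier
      weight z α = ∑ₗ (computations z α) prob

      Pr-weight : ∀ z α → Pr (𝓒ᴱ z α) (weight z α)
      Pr-weight z α = record
        { elements = computations z α
        ; unique   = computations-unique z α
        ; sound    = computations-sound z α
        ; complete = λ _ → computations-complete
        } , refl

      weight-nonneg : ∀ z α → 0# ≤ weight z α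
      weight-nonneg z α = ∑-nonneg (computations z α) prob-nonneg

      weight-[] : ∀ {z} → E z → weight z [] ≈ 1#
      weight-[] {z} e with lem {E z}
      ... | yes _ = +-identityʳ 1#
      ... | no ¬e = contradiction e ¬e

      weight-[]-0 : ∀ {z} → ¬ E z → weight z [] ≈ 0#
      weight-[]-0 {z} ¬e with lem {E z}
      ... | yes e = contradiction e ¬e
      ... | no _  = refl

      -- First-step decomposition: the enumeration branches over the support of the chosen target,
      -- and determinism exchanges that target for the given `π`.
      weight-∷ : ∀ {z a π} α → z ⟶[ a ] π →
                 weight z (a ∷ α) ≈ ∑ₗ (support π) (λ s → mass π s * weight s α)
      weight-∷ {z} {a} {π} α st with lem {∃[ ρ ] z ⟶[ a ] ρ}
      ... | no ¬st        = contradiction (π , st) ¬st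
      ... | yes (ρ , st′) = begin-equality
        ∑ₗ (concat (map branch (support ρ))) prob          ≈⟨ ∑-concat-map branch prob (support ρ) ⟩
        ∑ₗ (support ρ) (λ s → ∑ₗ (branch s) prob)          ≈⟨ ∑-cong (support ρ) ∑-branch ⟩
        ∑ₗ (support ρ) (λ s → mass ρ s * weight s α)       ≈⟨ ∑-support-cong ρ π (proj₂ (deterministic st′ st))
                                                                 (λ s → weight s α) ⟩
        ∑ₗ (support π) (λ s → mass π s * weight s α)       ∎
        where
        branch : State → List (List Step)
        branch s = map ((a , ρ , s) ∷_) (computations s α)
        ∑-branch : ∀ s → ∑ₗ (branch s) prob ≈ mass ρ s * weight s α
        ∑-branch s = trans (∑-map ((a , ρ , s) ∷_) prob (computations s α))
                           (sym (∑-distribˡ prob (mass ρ s) (computations s α)))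

      weight-∷-0 : ∀ {z a} α → ¬ (∃[ π ] z ⟶[ a ] π) → weight z (a ∷ α) ≈ 0#
      weight-∷-0 {z} {a} α ¬st with lem {∃[ π ] z ⟶[ a ] π}
      ... | yes st = contradiction st ¬st
      ... | no _   = refl

    -- Weights of traces and of maximal traces.

    Any-State : State → Set ℓ
    Any-State _ = ⊤

    tr mx : State → Word → Carrier
    tr = weight Any-State
    mx = weight Terminal

    tr-Pr : ∀ z α → Pr (𝓒 z α) (tr z α)
    tr-Pr z α = Pr-resp-≐ ((λ (c , p , _) → c , p) , λ (c , p) → c , p , _) (Pr-weight Any-State z α)

    -- Equal steps lead to the same state, so once `c` is used up any further step of `c′` would
    -- leave a terminal state.
    prefix-of-terminated : ∀ {z c c′} → Prefix (Setoid._≈_ stepSetoid) c c′ →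
                           Terminal (last z c) → IsComputation z c′ → c ≈ᶜ c′
    prefix-of-terminated []                    t []             = []
    prefix-of-terminated []                    t ((st , _) ∷ _) = contradiction (_ , _ , st) t
    prefix-of-terminated (p@(_ , _ , ≡.refl) ∷ ps) t (_ ∷ c′)   = p ∷ prefix-of-terminated ps t c′

    terminated⇒𝓒max : ∀ {z c} → IsComputation z c → Terminal (last z c) → 𝓒max z c
    terminated⇒𝓒max c t = c , λ (_ , c′ , p , ¬c≈c′) → ¬c≈c′ (prefix-of-terminated p t c′)

    -- An empty support would have total mass `0#`.
    support-inhabited : ∀ {X} (π : Distribution X) → ∃[ x ] x ∈supp π
    support-inhabited π = go elements sound (Distribution.total π)
      where
      open Enumeration (Distribution.finiteSupport π)
      go : ∀ xs → All (_∈supp π) xs → ∑ₗ xs (mass π) ≈ 1# → ∃[ x ] x ∈supp π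
      go []      _       0≈1 = contradiction 0≈1 0≉1
      go (x ∷ _) (p ∷ _) _   = x , p

    extend : ∀ {z c} x → IsComputation z c → IsComputation (last z c) [ x ] → IsComputation z (c ++ [ x ])
    extend x []       st = st
    extend x (st′ ∷ c) st = st′ ∷ extend x c st

    -- A transition from the last state has a target with inhabited support, so `c` could be
    -- extended by one step; the difference in length makes this extension proper.
    𝓒max⇒terminated : ∀ {z c} → 𝓒max z c → Terminal (last z c)
    𝓒max⇒terminated {z} {c} (isC , maximal) (a , π , st) with support-inhabited π
    ... | s , s∈π = maximal
      (c ++ [ x ] , extend x isC ((st , s∈π) ∷ []) , prefix c , λ p → longer c (Pointwise-length p))
      where
      x : Step
      x = a , π , s
      prefix : ∀ c → Prefix (Setoid._≈_ stepSetoid) c (c ++ [ x ])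
      prefix []      = []
      prefix (y ∷ c) = Setoid.refl stepSetoid {y} ∷ prefix c
      longer : ∀ c → length c ≢ length (c ++ [ x ])
      longer (_ ∷ c) = longer c ∘ ℕ.suc-injective

    trace⇒⊨ : ∀ {c} Φ → trace c ≡ word Φ → c ⊨ᶜ Φ × length c ≡ depth Φ
    trace⇒⊨ {[]}    ⊤ᶠ        _  = ⊤ᶠ , ≡.refl
    trace⇒⊨ {_ ∷ c} (⟨ a ⟩ Φ) tr with List.∷-injective tr
    ... | ≡.refl , tr′ with trace⇒⊨ Φ tr′
    ...   | c⊨Φ , len = ⟨⟩ c⊨Φ , ≡.cong suc len

    -- Satisfaction alone makes `word Φ` a prefix of the trace; the equality of lengths excludes a
    -- proper one.
    ⊨⇒trace : ∀ {c Φ} → c ⊨ᶜ Φ → length c ≡ depth Φ → trace c ≡ word Φ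
    ⊨⇒trace {[]} ⊤ᶠ        _   = ≡.refl
    ⊨⇒trace      (⟨⟩ c⊨Φ) len = ≡.cong (_ ∷_) (⊨⇒trace c⊨Φ (ℕ.suc-injective len))

    mx-Pr : ∀ z Φ → Pr (𝓒max⊨ z Φ) (mx z (word Φ))
    mx-Pr z Φ = Pr-resp-≐
      ( (λ (c , tr , t) → let (c⊨Φ , len) = trace⇒⊨ Φ tr in terminated⇒𝓒max c t , c⊨Φ , len)
      , (λ (max , c⊨Φ , len) → proj₁ max , ⊨⇒trace c⊨Φ len , 𝓒max⇒terminated max))
      (Pr-weight Terminal z (word Φ))

    -- Recursion for sums of maximal-trace weights.

    ∑-mx-step : ∀ {z a π} → z ⟶[ a ] π → (k : Word → Carrier) → ∀ U →
      ∑ₗ U (λ β → k β * mx z β) ≈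
      ∑ₗ (support π) (λ s → mass π s * ∑ₗ (residual a U) (λ β → k (a ∷ β) * mx s β))
    ∑-mx-step {z} {a} {π} st k U = begin-equality
      ∑ₗ U (λ β → k β * mx z β)
        ≈⟨ ∑-residual (λ β → k β * mx z β) mx[] mx∷ U ⟩
      ∑ₗ V (λ β → k (a ∷ β) * mx z (a ∷ β))
        ≈⟨ ∑-cong V (λ β → trans (*-congˡ (weight-∷ Terminal β st))
                                  (∑-distribˡ (λ s → mass π s * mx s β) (k (a ∷ β)) (support π))) ⟩
      ∑ₗ V (λ β → ∑ₗ (support π) (λ s → k (a ∷ β) * (mass π s * mx s β)))
        ≈⟨ ∑-swap (λ β s → k (a ∷ β) * (mass π s * mx s β)) V (support π) ⟩
      ∑ₗ (support π) (λ s → ∑ₗ V (λ β → k (a ∷ β) * (mass π s * mx s β)))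
        ≈⟨ ∑-cong (support π) (λ s → trans
             (∑-cong V (λ β → x∙yz≈y∙xz′ (k (a ∷ β)) (mass π s) (mx s β)))
             (sym (∑-distribˡ (λ β → k (a ∷ β) * mx s β) (mass π s) V))) ⟩
      ∑ₗ (support π) (λ s → mass π s * ∑ₗ V (λ β → k (a ∷ β) * mx s β)) ∎
      where
      open import Algebra.Properties.CommutativeSemigroup *-commutativeSemigroup
        using () renaming (x∙yz≈y∙xz to x∙yz≈y∙xz′)
      V = residual a U
      -- Only words starting with `a` contribute: `z` is not terminal, and determinism allows no
      -- other first action. The arbitrary factor `k` covers both total mass and prefix sums.
      mx[] : k [] * mx z [] ≈ 0#
      mx[] = trans (*-congˡ (weight-[]-0 Terminal λ t → t (a , π , st))) (zeroʳ _)
      mx∷ : ∀ {b β} → a ≢ b → k (b ∷ β) * mx z (b ∷ β) ≈ 0#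
      mx∷ {b} {β} a≢b = trans
        (*-congˡ (weight-∷-0 Terminal β λ (_ , st′) → a≢b (proj₁ (deterministic st st′))))
        (zeroʳ _)

    total-mx-step : ∀ {z a π} → z ⟶[ a ] π → ∀ U →
      ∑ₗ U (mx z) ≈ ∑ₗ (support π) (λ s → mass π s * ∑ₗ (residual a U) (mx s))
    total-mx-step {z} {a} {π} st U = begin-equality
      ∑ₗ U (mx z)
        ≈⟨ ∑-cong U (λ β → sym (*-identityˡ (mx z β))) ⟩
      ∑ₗ U (λ β → 1# * mx z β)
        ≈⟨ ∑-mx-step st (λ _ → 1#) U ⟩
      ∑ₗ (support π) (λ s → mass π s * ∑ₗ (residual a U) (λ β → 1# * mx s β))
        ≈⟨ ∑-cong (support π) (λ s → *-congˡ {mass π s} (∑-cong (residual a U) (λ β → *-identityˡ (mx s β)))) ⟩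
      ∑ₗ (support π) (λ s → mass π s * ∑ₗ (residual a U) (mx s)) ∎

    total-mass : ∀ {X} (π : Distribution X) → ∑ₗ (support π) (λ s → mass π s * 1#) ≈ 1#
    total-mass π = trans (∑-cong (support π) (λ s → *-identityʳ (mass π s))) (Distribution.total π)

    ∑-terminal : ∀ {z U} → Terminal z → Unique U → [] ∈ U → ∑ₗ U (mx z) ≈ 1#
    ∑-terminal {z} {U} t u []∈U = trans
      (∑-single (≡.setoid Word) (λ { ≡.refl → refl }) u []∈U mx≈0)
      (weight-[] Terminal t)
      where
      mx≈0 : ∀ {β} → β ∈ U → [] ≢ β → mx z β ≈ 0#
      mx≈0 {[]}    _ []≢[] = contradiction ≡.refl []≢[]
      mx≈0 {b ∷ β} _ _     = weight-∷-0 Terminal β λ (π , st) → t (b , π , st)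

    -- By well-founded induction: the sum at a nonterminal state is an average of sums at its
    -- successors, and a terminal state has all its mass on `[]`. Equality can fail because `U` may
    -- miss maximal traces.
    total-mx≤1 : ∀ {z} → Acc _successorOf_ z → ∀ {U} → Unique U → ∑ₗ U (mx z) ≤ 1#
    total-mx≤1 {z} (acc rs) {U} u with lem {∃[ a ] ∃[ π ] z ⟶[ a ] π}
    ... | yes (a , π , st) = begin
      ∑ₗ U (mx z)                                               ≈⟨ total-mx-step st U ⟩
      ∑ₗ (support π) (λ s → mass π s * ∑ₗ (residual a U) (mx s)) ≤⟨ ∑-mono (support π) (λ {s} s∈ →
        *-monoʳ-≤ (Distribution.nonneg π s)
          (total-mx≤1 (rs (a , π , st , ∈-support⇒∈supp π s∈)) (residual-unique u))) ⟩
      ∑ₗ (support π) (λ s → mass π s * 1#)                      ≈⟨ total-mass π ⟩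
      1#                                                        ∎
    ... | no t with lem {[] ∈ U}
    ...   | yes []∈U = ≤-reflexive (∑-terminal t u []∈U)
    ...   | no []∉U  = ≤-respˡ-≈ (sym (∑-zero U mx≈0)) 0≤1
      where
      mx≈0 : ∀ {β} → β ∈ U → mx z β ≈ 0#
      mx≈0 {[]}    []∈U = contradiction []∈U []∉U
      mx≈0 {b ∷ β} _    = weight-∷-0 Terminal β λ (π , st) → t (b , π , st)

    -- Finite sets that carry the whole maximal mass.

    -- Quantifying over all duplicate-free `U` above `B` makes the property monotone in `B`. Lists
    -- for several states can then simply be concatenated, with duplicates allowed in `B`.
    Exhausts : List Word → State → Set ℓ
    Exhausts B z = ∀ {U} → Unique U → (∀ {β} → β ∈ B → β ∈ U) → ∑ₗ U (mx z) ≈ 1#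

    exhausts-all : ∀ ss → (∀ {s} → s ∈ ss → ∃[ B ] Exhausts B s) →
                   ∃[ B ] (∀ {s} → s ∈ ss → Exhausts B s)
    exhausts-all []       _ = [] , λ ()
    exhausts-all (s ∷ ss) h with h (here ≡.refl) | exhausts-all ss (h ∘ there)
    ... | B , exh | C , exhs = B ++ C , λ
      { (here ≡.refl) u B++C⊆U → exh u (B++C⊆U ∘ ∈-++⁺ˡ)
      ; (there s∈ss)  u B++C⊆U → exhs s∈ss u (B++C⊆U ∘ ∈-++⁺ʳ B) }

    -- Supports are finite, so the lists of the successors merge into one; prefixing it with `a`
    -- works because the quotient of any `U` above `map (a ∷_) B` lies above `B`.
    exhaustive : ∀ {z} → Acc _successorOf_ z → ∃[ B ] Exhausts B z
    exhaustive {z} (acc rs) with lem {∃[ a ] ∃[ π ] z ⟶[ a ] π}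
    ... | no t = [ [] ] , λ u B⊆U → ∑-terminal t u (B⊆U (here ≡.refl))
    ... | yes (a , π , st) with exhausts-all (support π) (λ s∈ → exhaustive (rs (a , π , st , ∈-support⇒∈supp π s∈)))
    ...   | B , exh = map (a ∷_) B , λ {U} u aB⊆U → begin-equality
      ∑ₗ U (mx z)                                               ≈⟨ total-mx-step st U ⟩
      ∑ₗ (support π) (λ s → mass π s * ∑ₗ (residual a U) (mx s)) ≈⟨ ∑-cong∈ (support π) (λ {s} s∈ →
        *-congˡ {mass π s} (exh s∈ (residual-unique u) (∈-residual⁺ U ∘ aB⊆U ∘ ∈-map⁺ (a ∷_)))) ⟩
      ∑ₗ (support π) (λ s → mass π s * 1#)                      ≈⟨ total-mass π ⟩
      1#                                                        ∎

    tr-as-prefix-sum : ∀ {z U} → Unique U → ∑ₗ U (mx z) ≈ 1# →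
                       ∀ α → tr z α ≈ ∑ₗ U (λ β → ⟦ α ≼ β ⟧ * mx z β)
    tr-as-prefix-sum {z} {U} u total≈1 [] = begin-equality
      tr z []                  ≈⟨ weight-[] Any-State _ ⟩
      1#                       ≈⟨ total≈1 ⟨
      ∑ₗ U (mx z)              ≈⟨ ∑-cong U (λ β → sym (*-identityˡ (mx z β))) ⟩
      ∑ₗ U (λ β → 1# * mx z β) ∎
    tr-as-prefix-sum {z} {U} u total≈1 (a ∷ α) = by-enabledness lem
      where
      by-enabledness : Dec (∃[ π ] z ⟶[ a ] π) → tr z (a ∷ α) ≈ ∑ₗ U (λ β → ⟦ a ∷ α ≼ β ⟧ * mx z β)
      by-enabledness (no ¬st) = trans (weight-∷-0 Any-State α ¬st) (sym (∑-zero U λ {β} _ → vanish β))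
        where
        vanish : ∀ β → ⟦ a ∷ α ≼ β ⟧ * mx z β ≈ 0#
        vanish []      = zeroˡ _
        vanish (b ∷ β) with lem {a ≡ b}
        ... | yes ≡.refl = trans (*-congˡ (weight-∷-0 Terminal β ¬st)) (zeroʳ _)
        ... | no _       = zeroˡ _
      by-enabledness (yes (π , st)) = begin-equality
        tr z (a ∷ α)
          ≈⟨ weight-∷ Any-State α st ⟩
        ∑ₗ (support π) (λ s → mass π s * tr s α)
          ≈⟨ ∑-cong∈ (support π) (λ {s} s∈ → *-congˡ {mass π s}
               (tr-as-prefix-sum (residual-unique u) (residual-total s∈) α)) ⟩
        ∑ₗ (support π) (λ s → mass π s * ∑ₗ V (λ β → ⟦ α ≼ β ⟧ * mx s β))
          ≈⟨ ∑-cong (support π) (λ s → *-congˡ {mass π s}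
               (∑-cong V (λ β → *-congʳ {mx s β} (sym (≼-∷ a α β))))) ⟩
        ∑ₗ (support π) (λ s → mass π s * ∑ₗ V (λ β → ⟦ a ∷ α ≼ a ∷ β ⟧ * mx s β))
          ≈⟨ ∑-mx-step st ⟦ a ∷ α ≼_⟧ U ⟨
        ∑ₗ U (λ β → ⟦ a ∷ α ≼ β ⟧ * mx z β) ∎
        where
        V = residual a U
        -- An average of numbers ≤ 1 is 1 only if each of them is 1.
        residual-total : ∀ {s} → s ∈ support π → ∑ₗ V (mx s) ≈ 1#
        residual-total {s} s∈ = *-cancelˡ (∈-support⇒∈supp π s∈)
          (∑-squeeze (support π)
            (λ {s} _ → *-monoʳ-≤ (Distribution.nonneg π s) (total-mx≤1 (finite s) (residual-unique u)))
            (≤-reflexive (trans (total-mass π) (trans (sym total≈1) (total-mx-step st U)))) s∈)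

  -- Comparison of resolutions and the two implications.

  module _ (P : PTS) (finite : PTS.Finite P) where

    open PTS P using (State)

    -- Matched targets have equal masses, so `corr` maps successors to successors and
    -- well-foundedness pulls back along it.
    Resolution-finite : ∀ {s} (Z : Resolution P s) → PTS.Finite (Resolution.pts Z)
    Resolution-finite Z = Subrelation.wellFounded corr-successor (On.wellFounded corr finite)
      where
      open Resolution Z
      corr-successor : ∀ {z′ z} → z′ successorOf z → PTS._successorOf_ P (corr z′) (corr z)
      corr-successor {z′} (a , π , st , z′∈π) with matched st
      ... | π′ , st′ , π≈π′ = a , π′ , st′ , <-respʳ-≈ (π≈π′ z′) z′∈π

    module Behaviour {s} (Z : Resolution P s) where
      open Resolution Z
      open DeterministicPTS pts deterministic (Resolution-finite Z) public
      trᶻ mxᶻ : Word → Carrier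
      trᶻ = tr init
      mxᶻ = mx init
      exhaustiveᶻ : ∃[ B ] Exhausts B init
      exhaustiveᶻ = exhaustive (Resolution-finite Z init)

    module _ {s t} (Zs : Resolution P s) (Zt : Resolution P t) where
      private
        module S = Behaviour Zs
        module T = Behaviour Zt

      tr-determines-mx : (∀ α → S.trᶻ α ≈ T.trᶻ α) → ∀ β → S.mxᶻ β ≈ T.mxᶻ β
      tr-determines-mx tr≈ β with S.exhaustiveᶻ | T.exhaustiveᶻ
      ... | B , exhB | C , exhC = prefix-sums-determine S.mxᶻ T.mxᶻ u sums (∈-dedup⁺ {β ∷ B ++ C} (here ≡.refl))
        where
        -- One list for both resolutions: it contains an exhausting list of each, and also `β`,
        -- which may lie in neither.
        U = dedup (β ∷ B ++ C)
        u = dedup-unique (β ∷ B ++ C)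
        sums : ∀ α → ∑ₗ U (λ γ → ⟦ α ≼ γ ⟧ * S.mxᶻ γ) ≈ ∑ₗ U (λ γ → ⟦ α ≼ γ ⟧ * T.mxᶻ γ)
        sums α = trans (sym (S.tr-as-prefix-sum u (exhB u (∈-dedup⁺ {β ∷ B ++ C} ∘ there ∘ ∈-++⁺ˡ)) α))
                (trans (tr≈ α)
                       (T.tr-as-prefix-sum u (exhC u (∈-dedup⁺ {β ∷ B ++ C} ∘ there ∘ ∈-++⁺ʳ B)) α))

      -- Agreement on `U` gives the second resolution total mass `1#` there as well, so both satisfy
      -- the prefix-sum identity over the same list.
      mx-determines-tr : ∀ {U} → Unique U → ∑ₗ U S.mxᶻ ≈ 1# → (∀ {β} → β ∈ U → S.mxᶻ β ≈ T.mxᶻ β) →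
                         ∀ α → S.trᶻ α ≈ T.trᶻ α
      mx-determines-tr {U} u total≈1 mx≈ α = begin-equality
        S.trᶻ α                              ≈⟨ S.tr-as-prefix-sum u total≈1 α ⟩
        ∑ₗ U (λ β → ⟦ α ≼ β ⟧ * S.mxᶻ β)    ≈⟨ ∑-cong∈ U (λ {β} β∈U → *-congˡ {⟦ α ≼ β ⟧} (mx≈ β∈U)) ⟩
        ∑ₗ U (λ β → ⟦ α ≼ β ⟧ * T.mxᶻ β)    ≈⟨ T.tr-as-prefix-sum u (trans (sym (∑-cong∈ U mx≈)) total≈1) α ⟨
        T.trᶻ α                              ∎

    -- The resolution of `t` with the same trace probabilities also has the same maximal-trace
    -- weights, and these are all that a formula constrains.
    ⊑⇒𝓛⊆ : ∀ {s t} → _⊑_ P s t → ∀ {Ψ} → 𝓛 P s Ψ → 𝓛 P t Ψ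
    ⊑⇒𝓛⊆ s⊑t {Ψ} (Zs , sat) with s⊑t Zs
    ... | Zt , same = Zt , λ i →
      let (e , Σe≈mx) = T.mx-Pr _ (Φ i)
      in e , trans Σe≈mx (trans (sym (tr-determines-mx Zs Zt tr≈ (word (Φ i))))
                                (S.Pr-unique (S.mx-Pr _ (Φ i)) (sat i)))
      where
      open TraceDistributionFormula Ψ
      module S = Behaviour Zs
      module T = Behaviour Zt
      tr≈ : ∀ α → S.trᶻ α ≈ T.trᶻ α
      tr≈ α with same α
      ... | p , Prs , Prt = trans (S.Pr-unique (S.tr-Pr _ α) Prs) (T.Pr-unique Prt (T.tr-Pr _ α))

    -- The index set of a formula describing `Z`: positivity and total `1#` are the conditions on
    -- its coefficients.
    maximal-traces : ∀ {s} (Z : Resolution P s) → let open Behaviour Z in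
                     ∃[ U ] Unique U × (∀ {β} → β ∈ U → 0# < mxᶻ β) × ∑ₗ U mxᶻ ≈ 1#
    maximal-traces Z with Behaviour.exhaustiveᶻ Z
    ... | B , exh =
      filter positive? (dedup B) ,
      UniqueWords.filter⁺ positive? (dedup-unique B) ,
      (λ β∈ → proj₂ (∈-filter⁻ positive? {xs = dedup B} β∈)) ,
      trans (∑-filter-positive mxᶻ (weight-nonneg Terminal init) (dedup B)) (exh (dedup-unique B) ∈-dedup⁺)
      where
      open Resolution Z using (init)
      open Behaviour Z
      positive? : ∀ β → Dec (0# < mxᶻ β)
      positive? β = lem

    -- The formula `Ψ` records the maximal-trace weights of `Zs`, so `Zs` satisfies it. A resolution
    -- of `t` satisfying `Ψ` has the same weights on `U`, hence the same trace probabilities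
    -- everywhere.
    𝓛⊆⇒⊑ : ∀ {s t} → (∀ {Ψ} → 𝓛 P s Ψ → 𝓛 P t Ψ) → _⊑_ P s t
    𝓛⊆⇒⊑ {s} {t} 𝓛⊆ Zs with maximal-traces Zs
    -- A formula has at least one summand; an empty list would have total `0#`.
    ... | []      , _ , _   , 0≈1     = contradiction 0≈1 0≉1
    ... | (γ ∷ V) , u , pos , total≈1 = Zt , λ α →
      let (e , Σe≈tr) = S.tr-Pr _ α
      in T.trᶻ α , (e , trans Σe≈tr (mx-determines-tr Zs Zt u total≈1 mx≈ α)) , T.tr-Pr _ α
      where
      module S = Behaviour Zs
      U = γ ∷ V
      mx-formula : ∀ β → S.mxᶻ (word (formula β)) ≈ S.mxᶻ β
      mx-formula β = reflexive (≡.cong S.mxᶻ (word-formula β))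
      Ψ : TraceDistributionFormula
      Ψ = record
        { size-1   = length V
        ; r        = S.mxᶻ ∘ lookup U
        ; Φ        = formula ∘ lookup U
        ; distinct = λ {i} {j} eq → lookup-injective u i j
            (≡.trans (≡.sym (word-formula (lookup U i)))
              (≡.trans (≡.cong word eq) (word-formula (lookup U j))))
        ; r>0      = λ i → pos (∈-lookup i)
        -- A single weight is the total over a one-word list.
        ; r≤1      = λ i → ≤-respˡ-≈ (+-identityʳ _)
            (S.total-mx≤1 (Resolution-finite Zs _) {[ lookup U i ]} ([] ∷ []))
        ; r-total  = total≈1
        }
      t⊨Ψ : _⊨_ P t Ψ
      t⊨Ψ = 𝓛⊆ {Ψ} (Zs , λ i → let (e , Σe≈mx) = S.mx-Pr _ (formula (lookup U i))
                            in e , trans Σe≈mx (mx-formula (lookup U i)))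
      Zt = proj₁ t⊨Ψ
      module T = Behaviour Zt
      mx≈ : ∀ {β} → β ∈ U → S.mxᶻ β ≈ T.mxᶻ β
      mx≈ {β} β∈U with Any.index β∈U | Any.lookup-index β∈U
      ... | i | ≡.refl = begin-equality
        S.mxᶻ β                  ≈⟨ T.Pr-unique (T.mx-Pr _ (formula β)) (proj₂ t⊨Ψ i) ⟨
        T.mxᶻ (word (formula β)) ≡⟨ ≡.cong T.mxᶻ (word-formula β) ⟩
        T.mxᶻ β                  ∎

theorem10 : ∀ {ℓ} → ExcludedMiddle ℓ →
    (F : OrderedField ℓ) (Act : Set ℓ) →
    let open Processes F Act in
    (P : PTS) → PTS.ImageFinite P → PTS.Finite P →
    ∀ (s t : PTS.State P) →
    StrongTraceEquivalent P s t ⇔ (𝓛 P s ≐ 𝓛 P t)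
theorem10 lem F Act P _ finite s t = mk⇔
  (λ (s⊑t , t⊑s) → (λ {Ψ} → ⊑⇒𝓛⊆ P finite s⊑t {Ψ}) , λ {Ψ} → ⊑⇒𝓛⊆ P finite t⊑s {Ψ})
  (λ (s⊆t , t⊆s) → 𝓛⊆⇒⊑ P finite (λ {Ψ} → s⊆t {Ψ}) , 𝓛⊆⇒⊑ P finite (λ {Ψ} → t⊆s {Ψ}))
  where open Classical lem F Act
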